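{- Let $G$ and $H$ be finite groups such that $|G|$ and $|H|$ have the same prime divisors, and let $\alpha\colon G\to\operatorname{Aut}(H)$ be an action by automorphisms. Then every connected component of $\mathcal{C}(\alpha)$ has diameter at most $4$ (i.e. any two vertices in the same connected component are joined by a path of length at most $4$).
   Context: For an action $\alpha$ of a finite group $G$ on a finite group $H$ by automorphisms, $\mathcal{C}(\alpha)$ is the simple undirected graph whose vertices are the non-trivial orbits of the action (orbits of size $>1$), two distinct vertices $L_1,L_2$ being adjacent if and only if $\gcd(|L_1|,|L_2|)\neq 1$. -}

module Defs where

open import Algebra.Bundles using (Group)
open import Algebra.Morphism.Bundles using (GroupHomomorphism)
open import Algebra.Morphism.Structures using (IsGroupIsomorphism)
open import Data.Fin.Base using (Fin)
open import Data.Fin.Subset using (Subset; _∈_; ∣_∣)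
open import Data.List.Base using (List; []; _∷_)
open import Data.Nat.Base using (ℕ; zero; suc; _<_)
open import Data.Nat.GCD using (gcd; gcd-comm)
open import Data.Product.Base using (Σ; ∃-syntax; _×_; _,_; proj₁; proj₂)
open import Function.Base using (_∘_; id)
open import Function.Bundles using (Inverse; _⇔_)
open import Level using (Level; 0ℓ; _⊔_) renaming (suc to lsuc)
open import Relation.Binary.Bundles using (Setoid)
open import Relation.Binary.Core using (Rel)
open import Relation.Binary.Definitions using (Symmetric; Irreflexive; _Respects₂_)
open import Relation.Binary.PropositionalEquality as ≡ using (_≡_; _≢_)
import Algebra.Morphism.Construct.Composition as Compose
import Algebra.Morphism.Construct.Identity as Identity
import Data.List.Relation.Unary.Unique.Setoid as UniqueSetoid
import Relation.Binary.Construct.On as On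
import Relation.Binary.Reasoning.Setoid as SetoidReasoning

------------------------------------------------------------------------
-- Finite groups

record FiniteGroup (c ℓ : Level) : Set (lsuc (c ⊔ ℓ)) where
  field
    group       : Group c ℓ
    order       : ℕ
    -- Elements are counted up to the group's own equality _≈_.
    enumeration : Inverse (Group.setoid group) (≡.setoid (Fin order))

  open Group group public

  index : Carrier → Fin order
  index = Inverse.to enumeration

------------------------------------------------------------------------
-- Automorphism groups

module _ {c ℓ} (H : Group c ℓ) where

  open Group H

  record Automorphism : Set (c ⊔ ℓ) where
    field
      ⟦_⟧                : Carrier → Carrier
      isGroupIsomorphism : IsGroupIsomorphism rawGroup rawGroup ⟦_⟧

    open IsGroupIsomorphism isGroupIsomorphism public

  open Automorphism using (⟦_⟧; ⟦⟧-cong)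

  private

    invert : Automorphism → Automorphism
    invert φ = record
      { ⟦_⟧ = f⁻¹
      ; isGroupIsomorphism = record
        { isGroupMonomorphism = record
          { isGroupHomomorphism = record
            { isMonoidHomomorphism = record
              { isMagmaHomomorphism = record
                { isRelHomomorphism = record { cong = f⁻¹-cong }
                ; homo = λ x y → φ.injective (begin
                    φ.⟦ f⁻¹ (x ∙ y) ⟧            ≈⟨ f-f⁻¹ (x ∙ y) ⟩
                    x ∙ y                        ≈⟨ ∙-cong (f-f⁻¹ x) (f-f⁻¹ y) ⟨
                    φ.⟦ f⁻¹ x ⟧ ∙ φ.⟦ f⁻¹ y ⟧    ≈⟨ φ.∙-homo (f⁻¹ x) (f⁻¹ y) ⟨
                    φ.⟦ f⁻¹ x ∙ f⁻¹ y ⟧          ∎)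
                }
              ; ε-homo = φ.injective (trans (f-f⁻¹ ε) (sym φ.ε-homo))
              }
            ; ⁻¹-homo = λ x → φ.injective (begin
                φ.⟦ f⁻¹ (x ⁻¹) ⟧    ≈⟨ f-f⁻¹ (x ⁻¹) ⟩
                x ⁻¹                ≈⟨ ⁻¹-cong (f-f⁻¹ x) ⟨
                φ.⟦ f⁻¹ x ⟧ ⁻¹      ≈⟨ φ.⁻¹-homo (f⁻¹ x) ⟨
                φ.⟦ f⁻¹ x ⁻¹ ⟧      ∎)
            }
          ; injective = λ {x} {y} eq →
              trans (sym (f-f⁻¹ x)) (trans (φ.⟦⟧-cong eq) (f-f⁻¹ y))
          }
        ; surjective = λ x → φ.⟦ x ⟧ , λ {y} eq → φ.injective (trans (f-f⁻¹ y) eq)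
        }
      }
      where
      module φ = Automorphism φ
      open SetoidReasoning setoid

      f⁻¹ : Carrier → Carrier
      f⁻¹ y = proj₁ (φ.surjective y)

      f-f⁻¹ : ∀ y → φ.⟦ f⁻¹ y ⟧ ≈ y
      f-f⁻¹ y = proj₂ (φ.surjective y) refl

      f⁻¹-cong : ∀ {x y} → x ≈ y → f⁻¹ x ≈ f⁻¹ y
      f⁻¹-cong {x} {y} x≈y =
        φ.injective (trans (f-f⁻¹ x) (trans x≈y (sym (f-f⁻¹ y))))

    rightInverse : ∀ φ x → ⟦ φ ⟧ (⟦ invert φ ⟧ x) ≈ x
    rightInverse φ x = proj₂ (Automorphism.surjective φ x) refl

    leftInverse : ∀ φ x → ⟦ invert φ ⟧ (⟦ φ ⟧ x) ≈ x
    leftInverse φ x = Automorphism.injective φ (rightInverse φ (⟦ φ ⟧ x))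

  Aut : Group (c ⊔ ℓ) (c ⊔ ℓ)
  Aut = record
    { Carrier = Automorphism
    ; _≈_     = λ φ ψ → ∀ x → ⟦ φ ⟧ x ≈ ⟦ ψ ⟧ x
    ; _∙_     = λ φ ψ → record
      { ⟦_⟧                = ⟦ φ ⟧ ∘ ⟦ ψ ⟧
      ; isGroupIsomorphism = Compose.isGroupIsomorphism trans
          (Automorphism.isGroupIsomorphism ψ) (Automorphism.isGroupIsomorphism φ)
      }
    ; ε       = record
      { ⟦_⟧                = id
      ; isGroupIsomorphism = Identity.isGroupIsomorphism rawGroup refl
      }
    ; _⁻¹     = invert
    ; isGroup = record
      { isMonoid = record
        { isSemigroup = record
          { isMagma = record
            { isEquivalence = record
              { refl  = λ _ → refl
              ; sym   = λ p x → sym (p x)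
              ; trans = λ p q x → trans (p x) (q x)
              }
            ; ∙-cong = λ {φ} {_} {_} {ψ′} p q x →
                trans (⟦⟧-cong φ (q x)) (p (⟦ ψ′ ⟧ x))
            }
          ; assoc = λ _ _ _ _ → refl
          }
        ; identity = (λ _ _ → refl) , (λ _ _ → refl)
        }
      ; inverse = leftInverse , rightInverse
      ; ⁻¹-cong = λ {φ} {ψ} p x → Automorphism.injective φ (begin
          ⟦ φ ⟧ (⟦ invert φ ⟧ x)    ≈⟨ rightInverse φ x ⟩
          x                          ≈⟨ rightInverse ψ x ⟨
          ⟦ ψ ⟧ (⟦ invert ψ ⟧ x)    ≈⟨ p (⟦ invert ψ ⟧ x) ⟨
          ⟦ φ ⟧ (⟦ invert ψ ⟧ x)    ∎)
      }
    }
    where open SetoidReasoning setoid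

------------------------------------------------------------------------
-- Simple graphs

record SimpleGraph v e a : Set (lsuc (v ⊔ e ⊔ a)) where
  field
    vertices   : Setoid v e

  open Setoid vertices public using () renaming (Carrier to Vertex; _≈_ to _≈ᵥ_)

  field
    Adj        : Rel Vertex a
    adj-resp-≈ : Adj Respects₂ _≈ᵥ_
    adj-sym    : Symmetric Adj
    adj-irrefl : Irreflexive _≈ᵥ_ Adj

  -- The index ℕ is the length, i.e. the number of edges.
  data Walk : ℕ → Vertex → Vertex → Set (v ⊔ e ⊔ a) where
    nil  : ∀ {x y} → x ≈ᵥ y → Walk zero x y
    cons : ∀ {k x y z} → Adj x y → Walk k y z → Walk (suc k) x z

  visited : ∀ {k x y} → Walk k x y → List Vertex
  visited (nil {x} _)      = x ∷ []
  visited (cons {x = x} _ w) = x ∷ visited w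

  open UniqueSetoid vertices using (Unique)

  Path : ℕ → Vertex → Vertex → Set (v ⊔ e ⊔ a)
  Path k x y = Σ (Walk k x y) λ w → Unique (visited w)

  SameComponent : Rel Vertex (v ⊔ e ⊔ a)
  SameComponent x y = ∃[ k ] Path k x y

------------------------------------------------------------------------
-- Actions by automorphisms and their common divisor graph

Action : ∀ {c₁ ℓ₁ c₂ ℓ₂} → FiniteGroup c₁ ℓ₁ → FiniteGroup c₂ ℓ₂ →
         Set (c₁ ⊔ ℓ₁ ⊔ c₂ ⊔ ℓ₂)
Action G H = GroupHomomorphism (FiniteGroup.rawGroup G)
                               (Group.rawGroup (Aut (FiniteGroup.group H)))

module _ {c₁ ℓ₁ c₂ ℓ₂} {G : FiniteGroup c₁ ℓ₁} {H : FiniteGroup c₂ ℓ₂}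
         (α : Action G H) where

  private
    module G = FiniteGroup G
    module H = FiniteGroup H

  act : G.Carrier → H.Carrier → H.Carrier
  act g = Automorphism.⟦_⟧ (GroupHomomorphism.⟦_⟧ α g)

  -- Subsets of H are encoded, through the enumeration of H, as subsets of
  -- Fin H.order, so that ∣_∣ is the number of elements up to H._≈_.
  IsOrbitOf : H.Carrier → Subset H.order → Set (c₁ ⊔ c₂ ⊔ ℓ₂)
  IsOrbitOf h L = ∀ x → H.index x ∈ L ⇔ (∃[ g ] act g h H.≈ x)

  record NontrivialOrbit : Set (c₁ ⊔ c₂ ⊔ ℓ₂) where
    field
      points     : Subset H.order
      isOrbit    : ∃[ h ] IsOrbitOf h points
      nontrivial : 1 < ∣ points ∣

    size : ℕ
    size = ∣ points ∣

  open NontrivialOrbit using (points; size)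

  -- Two vertices are equal when they are the same subset of H, whatever
  -- representative h is recorded in isOrbit.
  commonDivisorGraph : SimpleGraph (c₁ ⊔ c₂ ⊔ ℓ₂) 0ℓ 0ℓ
  commonDivisorGraph = record
    { vertices   = On.setoid (≡.setoid (Subset H.order)) points
    ; Adj        = λ L₁ L₂ → points L₁ ≢ points L₂ × gcd (size L₁) (size L₂) ≢ 1
    ; adj-resp-≈ =
        (λ { {L} eq (p , q) →
             (λ r → p (≡.trans r (≡.sym eq))) ,
             (λ r → q (≡.trans (≡.cong (gcd (size L) ∘ ∣_∣) eq) r)) }) ,
        (λ { {L} eq (p , q) →
             (λ r → p (≡.trans eq r)) ,
             (λ r → q (≡.trans (≡.cong (λ s → gcd ∣ s ∣ (size L)) eq) r)) })
    ; adj-sym    = λ { {L₁} {L₂} (p , q) →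
        (λ r → p (≡.sym r)) ,
        (λ r → q (≡.trans (gcd-comm (size L₁) (size L₂)) r)) }
    ; adj-irrefl = λ eq (p , _) → p eq
    }

{-# OPTIONS --safe #-}

-- If A and B are orbits of coprime sizes then G is transitive on A × B, so AB
-- is an orbit; its size divides |A||B| and is at least |A| and |B|.  Let
-- |A| < |B|.  Either |AB| shares a prime with each of |A| and |B|, so that A and
-- B are joined by a walk of length at most 2 through AB, or |AB| = |B|.  In the
-- latter case aB = AB for all a ∈ A, so every a⁻¹a′ stabilises B under left
-- multiplication.  The order of a subgroup stabilising two subsets of H divides
-- both cardinalities, hence subsets of coprime sizes have no nontrivial common
-- stabiliser.  Now take a walk of length 5 whose ends L and N satisfy
-- |L| < |N| and let M be its fourth vertex.  If L and M, L and N were not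
-- joined by walks of length at most 2, nor M and N adjacent or equal, then
-- either |L| < |M| and both M and N are stabilised by some a⁻¹a′ with
-- a ≠ a′ ∈ L; or |M| < |L|, and some b⁻¹b′ with b ≠ b′ ∈ M stabilises L and
-- therefore also LN = aN (a ∈ L), a set of the same size as N.

module Submission where

open import Defs
open import Algebra.Bundles using (Group; CommutativeSemiring)
open import Algebra.Bundles.Raw using (RawGroup)
open import Algebra.Core using (Op₂)
open import Algebra.Morphism.Bundles using (GroupHomomorphism)
open import Algebra.Morphism.Structures using (IsGroupMonomorphism)
open import Algebra.Structures using (IsGroup)
open import Data.Bool.Base using (if_then_else_)
open import Data.Bool.Properties using () renaming (_≟_ to _≟ᵇ_)
open import Data.Empty using (⊥-elim)
open import Data.Fin.Base using (Fin; zero; suc)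
open import Data.Fin.Permutation using (Permutation′; permutation)
open import Data.Fin.Properties using (any?; all?; suc-injective) renaming (_≟_ to _≟ᶠ_)
open import Data.Fin.Subset using (Subset; inside; outside; _∈_; _∉_)
open import Data.Fin.Subset.Properties using (_∈?_; x∈p∧x≢y⇒x∈p-y; x∈p⇒∣p-x∣<∣p∣)
open import Data.List.Relation.Unary.All as All using ([]; _∷_)
open import Data.List.Relation.Unary.All.Properties using (¬Any⇒All¬)
open import Data.List.Relation.Unary.AllPairs using ([]; _∷_)
open import Data.List.Relation.Unary.Any as Any using (Any; here; there)
open import Data.Nat.Base using (ℕ; zero; suc; _+_; _*_; _≤_; _<_; z≤n; s≤s; >-nonZero)
open import Data.Nat.Coprimality as Coprimality using (Coprime; coprime?; coprime-divisor; gcd≡1⇒coprime)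
open import Data.Nat.Divisibility
  using (_∣_; _∣0; ∣⇒≤; ∣-refl; ∣-reflexive; ∣m∣n⇒∣m+n; divides; divides-refl)
open import Data.Nat.Induction using (<-wellFounded)
open import Data.Nat.Primality using (Prime)
open import Data.Nat.Properties hiding (suc-injective)
open import Data.Product.Base using (_×_; _,_; ∃-syntax; proj₁; proj₂)
open import Data.Sum.Base using (_⊎_; inj₁; inj₂)
open import Data.Vec.Base using ([]; _∷_; tabulate; here; there)
open import Data.Vec.Properties using (≡-dec; lookup∘tabulate; []=⇒lookup; lookup⇒[]=)
open import Function.Base using (_∘_)
open import Function.Bundles using (_⇔_; mk⇔; Equivalence; Inverse)
open import Induction.WellFounded using (Acc; acc)
open import Level using (_⊔_)
open import Relation.Binary.Bundles using (module Setoid)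
open import Relation.Binary.Definitions using (Decidable; tri<; tri≈; tri>)
open import Relation.Binary.PropositionalEquality as ≡ using (_≡_; _≢_; _≗_)
open import Relation.Binary.Structures using (IsEquivalence)
open import Relation.Nullary using (Dec; yes; no; does; ¬_; contradiction)
open import Relation.Nullary.Decidable using (dec-true; map′; ¬?; decidable-stable; _×-dec_)
import Algebra.Morphism.GroupMonomorphism as GroupMonomorphism
import Algebra.Properties.Semiring.Sum as SemiringSum

-- Walks, bounded walks and paths in a simple graph.

module Walks {v e a} (Γ : SimpleGraph v e a) where

  open SimpleGraph Γ
  open Setoid vertices using (refl; sym; trans)

  Walk≤ : ℕ → Vertex → Vertex → Set (v ⊔ e ⊔ a)
  Walk≤ n x y = ∃[ k ] (k ≤ n × Walk k x y)

  walk-respˡ : ∀ {k x y z} → x ≈ᵥ y → Walk k y z → Walk k x z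
  walk-respˡ x≈y (nil y≈z)  = nil (trans x≈y y≈z)
  walk-respˡ x≈y (cons p w) = cons (proj₂ adj-resp-≈ (sym x≈y) p) w

  infixr 5 _++_

  _++_ : ∀ {k l x y z} → Walk k x y → Walk l y z → Walk (k + l) x z
  nil x≈y  ++ w′ = walk-respˡ x≈y w′
  cons p w ++ w′ = cons p (w ++ w′)

  reverse : ∀ {k x y} → Walk k x y → Walk k y x
  reverse (nil x≈y) = nil (sym x≈y)
  reverse {suc k} {x} {y} (cons p w) =
    ≡.subst (λ l → Walk l y x) (+-comm k 1) (reverse w ++ cons (adj-sym p) (nil refl))

  split : ∀ k {l x z} → Walk (k + l) x z → ∃[ y ] (Walk k x y × Walk l y z)
  split zero    w          = _ , nil refl , w
  split (suc k) (cons p w) with split k w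
  ... | y , u , v = y , cons p u , v

  infixr 5 _++≤_

  _++≤_ : ∀ {m n x y z} → Walk≤ m x y → Walk≤ n y z → Walk≤ (m + n) x z
  (k , k≤m , w) ++≤ (l , l≤n , w′) = k + l , +-mono-≤ k≤m l≤n , w ++ w′

  reverse≤ : ∀ {n x y} → Walk≤ n x y → Walk≤ n y x
  reverse≤ (k , k≤n , w) = k , k≤n , reverse w

  weaken : ∀ {m n x y} → m ≤ n → Walk≤ m x y → Walk≤ n x y
  weaken m≤n (k , k≤m , w) = k , ≤-trans k≤m m≤n , w

  exact : ∀ {k x y} → Walk k x y → Walk≤ k x y
  exact w = _ , ≤-refl , w

  -- A walk of length n + 1 arises at the first failure of the induction, so
  -- it suffices to shorten those.
  shorten : ∀ {n} → (∀ {x y} → Walk (suc n) x y → Walk≤ n x y) →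
            ∀ {k x y} → Walk k x y → Walk≤ n x y
  shorten s (nil x≈y) = zero , z≤n , nil x≈y
  shorten {n} s (cons p w) with shorten s w
  ... | k , k≤n , w′ with k ≟ n
  ...   | yes ≡.refl = s (cons p w′)
  ...   | no k≢n     = suc k , ≤∧≢⇒< k≤n k≢n , cons p w′

  path-respˡ : ∀ {k x y z} → x ≈ᵥ y → Path k y z → Path k x z
  path-respˡ x≈y (nil y≈z , _)      = nil (trans x≈y y≈z) , [] ∷ []
  path-respˡ x≈y (cons p w , u ∷ us) =
    walk-respˡ x≈y (cons p w) , All.map (λ y≉v x≈v → y≉v (trans (sym x≈y) x≈v)) u ∷ us

  -- When `x` already occurs on the path, prepending it would close a cycle; the part from that
  -- occurrence onwards serves instead.
  path-from : ∀ {k x y z} (w : Path k y z) → Any (x ≈ᵥ_) (visited (proj₁ w)) →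
              ∃[ l ] (l ≤ k × Path l x z)
  path-from w@(nil _ , _)       (here x≈y)  = _ , ≤-refl , path-respˡ x≈y w
  path-from w@(cons _ _ , _)    (here x≈y)  = _ , ≤-refl , path-respˡ x≈y w
  path-from (cons p w , _ ∷ us) (there x∈w) with path-from (w , us) x∈w
  ... | l , l≤k , w′ = l , m≤n⇒m≤1+n l≤k , w′

  -- Loop erasure from the far end: each new vertex is either fresh and prepended, or already
  -- visited, and then the detour is dropped.
  walk⇒path : Decidable _≈ᵥ_ → ∀ {k x y} → Walk k x y → ∃[ l ] (l ≤ k × Path l x y)
  walk⇒path _≈?_ (nil x≈y) = zero , z≤n , nil x≈y , [] ∷ []
  walk⇒path _≈?_ {x = x} (cons p w) with walk⇒path _≈?_ w
  ... | l , l≤k , w′ with Any.any? (x ≈?_) (visited (proj₁ w′))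
  ...   | no x∉w = suc l , s≤s l≤k , cons p (proj₁ w′) , ¬Any⇒All¬ _ x∉w ∷ proj₂ w′
  ...   | yes x∈w with path-from w′ x∈w
  ...     | m , m≤l , w″ = m , m≤n⇒m≤1+n (≤-trans m≤l l≤k) , w″

open SemiringSum (CommutativeSemiring.semiring +-*-commutativeSemiring)
  using ( sum; sum-cong-≗; sum-replicate-zero; ∑-comm; ∑-distrib-+; ∑-permute
        ; *-distribˡ-sum; *-distribʳ-sum)

-- Finite sums, indicators and cardinalities of subsets.

module Sums where

  open Data.Fin.Subset using (∣_∣)

  sum-mono-≤ : ∀ {n} {f g : Fin n → ℕ} → (∀ i → f i ≤ g i) → sum f ≤ sum g
  sum-mono-≤ {zero}  f≤g = z≤n
  sum-mono-≤ {suc n} f≤g = +-mono-≤ (f≤g zero) (sum-mono-≤ (f≤g ∘ suc))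

  -- Equal sums leave no room for a strict inequality at any index. For indicators this turns an
  -- inclusion of sets of equal size into equality.
  ≤∧sum≡⇒≗ : ∀ {n} {f g : Fin n → ℕ} → (∀ i → f i ≤ g i) → sum f ≡ sum g → f ≗ g
  ≤∧sum≡⇒≗ {suc n} {f} {g} f≤g eq = λ
    { zero    → head-eq
    ; (suc i) → ≤∧sum≡⇒≗ (f≤g ∘ suc)
                  (+-cancelˡ-≡ (f zero) _ _ (≡.trans eq (≡.cong (_+ sum (g ∘ suc)) (≡.sym head-eq)))) i
    }
    where
    head-eq : f zero ≡ g zero
    head-eq = ≤-antisym (f≤g zero) (+-cancelʳ-≤ (sum (g ∘ suc)) _ _ (begin
      g zero + sum (g ∘ suc) ≡⟨ eq ⟨
      f zero + sum (f ∘ suc) ≤⟨ +-monoʳ-≤ (f zero) (sum-mono-≤ (f≤g ∘ suc)) ⟩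
      f zero + sum (g ∘ suc) ∎))
      where open ≤-Reasoning

  term≤sum : ∀ {n} (f : Fin n → ℕ) i → f i ≤ sum f
  term≤sum f zero    = m≤m+n _ _
  term≤sum f (suc i) = ≤-trans (term≤sum (f ∘ suc) i) (m≤n+m _ (f zero))

  sum-zero : ∀ {n} {f : Fin n → ℕ} → (∀ i → f i ≡ 0) → sum f ≡ 0
  sum-zero {n} f≡0 = ≡.trans (sum-cong-≗ f≡0) (sum-replicate-zero n)

  -- Truth values as natural numbers: cardinalities become sums, and double counting becomes an
  -- exchange of summations.
  𝟙 : ∀ {p} {P : Set p} → Dec P → ℕ
  𝟙 P? = if does P? then 1 else 0

  𝟙-yes : ∀ {p} {P : Set p} (P? : Dec P) → P → 𝟙 P? ≡ 1
  𝟙-yes (yes _) _ = ≡.refl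
  𝟙-yes (no ¬p) p = contradiction p ¬p

  𝟙-no : ∀ {p} {P : Set p} (P? : Dec P) → ¬ P → 𝟙 P? ≡ 0
  𝟙-no (yes p) ¬p = contradiction p ¬p
  𝟙-no (no _)  _  = ≡.refl

  𝟙≡1⇒ : ∀ {p} {P : Set p} (P? : Dec P) → 𝟙 P? ≡ 1 → P
  𝟙≡1⇒ (yes p) _ = p

  𝟙-mono : ∀ {p q} {P : Set p} {Q : Set q} (P? : Dec P) (Q? : Dec Q) → (P → Q) → 𝟙 P? ≤ 𝟙 Q?
  𝟙-mono (no _)  Q? f = z≤n
  𝟙-mono (yes p) Q? f = ≤-reflexive (≡.sym (𝟙-yes Q? (f p)))

  𝟙-cong : ∀ {p q} {P : Set p} {Q : Set q} (P? : Dec P) (Q? : Dec Q) →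
           (P → Q) → (Q → P) → 𝟙 P? ≡ 𝟙 Q?
  𝟙-cong P? Q? f g = ≤-antisym (𝟙-mono P? Q? f) (𝟙-mono Q? P? g)

  χ : ∀ {n} → Subset n → Fin n → ℕ
  χ p i = 𝟙 (i ∈? p)

  ∣p∣≡sum-χ : ∀ {n} (p : Subset n) → ∣ p ∣ ≡ sum (χ p)
  ∣p∣≡sum-χ [] = ≡.refl
  ∣p∣≡sum-χ (inside  ∷ p) = ≡.cong suc (∣p∣≡sum-χ p)
  ∣p∣≡sum-χ (outside ∷ p) = (∣p∣≡sum-χ p)

  comprehension : ∀ {n p} {P : Fin n → Set p} → (∀ i → Dec (P i)) → Subset n
  comprehension P? = tabulate (does ∘ P?)

  module _ {n p} {P : Fin n → Set p} (P? : ∀ i → Dec (P i)) where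

    ∈-comprehension⁺ : ∀ {i} → P i → i ∈ comprehension P?
    ∈-comprehension⁺ {i} Pi = lookup⇒[]= i _ (≡.trans (lookup∘tabulate _ i) (dec-true (P? i) Pi))

    ∈-comprehension⁻ : ∀ {i} → i ∈ comprehension P? → P i
    ∈-comprehension⁻ {i} i∈ with P? i | ≡.trans (≡.sym (lookup∘tabulate (does ∘ P?) i)) ([]=⇒lookup i∈)
    ... | yes Pi | _ = Pi

  nonempty : ∀ {n} {p : Subset n} → 0 < ∣ p ∣ → ∃[ x ] x ∈ p
  nonempty {p = inside  ∷ p} _   = zero , here
  nonempty {p = outside ∷ p} 0<p with nonempty {p = p} 0<p
  ... | x , x∈p = suc x , there x∈p

  two-elements : ∀ {n} {p : Subset n} → 1 < ∣ p ∣ → ∃[ x ] ∃[ y ] (x ∈ p × y ∈ p × x ≢ y)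
  two-elements {p = inside  ∷ p} (s≤s 0<p) with nonempty {p = p} 0<p
  ... | y , y∈p = zero , suc y , here , there y∈p , λ ()
  two-elements {p = outside ∷ p} 1<p with two-elements {p = p} 1<p
  ... | x , y , x∈p , y∈p , x≢y =
    suc x , suc y , there x∈p , there y∈p , x≢y ∘ suc-injective

  x∈p⇒0<∣p∣ : ∀ {n} {p : Subset n} {x} → x ∈ p → 0 < ∣ p ∣
  x∈p⇒0<∣p∣ x∈p = ≤-<-trans z≤n (x∈p⇒∣p-x∣<∣p∣ x∈p)

  x≢y∈p⇒1<∣p∣ : ∀ {n} {p : Subset n} {x y} → x ∈ p → y ∈ p → x ≢ y → 1 < ∣ p ∣
  x≢y∈p⇒1<∣p∣ x∈p y∈p x≢y =
    ≤-<-trans (x∈p⇒0<∣p∣ (x∈p∧x≢y⇒x∈p-y x∈p x≢y)) (x∈p⇒∣p-x∣<∣p∣ y∈p)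

  -- Peeling off the class of an element of the support leaves an invariant
  -- function of smaller sum.
  class-size∣sum : ∀ {n} {R : Fin n → Fin n → Set} (R? : Decidable R) → IsEquivalence R →
                   ∀ m → (∀ x → sum (λ y → 𝟙 (R? x y)) ≡ m) →
                   ∀ (f : Fin n → ℕ) → (∀ {x y} → R x y → f x ≡ f y) → m ∣ sum f
  class-size∣sum {n} {R} R? isEquivalence m size f inv = go f inv (<-wellFounded (sum f))
    where
    open IsEquivalence isEquivalence

    go : ∀ f → (∀ {x y} → R x y → f x ≡ f y) → Acc _<_ (sum f) → m ∣ sum f
    go f inv (acc rec) with any? (λ x → ¬? (f x ≟ 0))
    ... | no  ¬supp = ≡.subst (m ∣_) (≡.sym (sum-zero λ x →
            decidable-stable (f x ≟ 0) (λ fx≢0 → ¬supp (x , fx≢0)))) (m ∣0)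
    ... | yes (x , fx≢0) = ≡.subst (m ∣_) (≡.sym total)
            (∣m∣n⇒∣m+n (divides-refl (f x)) (go f′ inv′ (rec smaller)))
      where
      f′ : Fin n → ℕ
      f′ y = if does (R? x y) then 0 else f y

      split : ∀ y → f y ≡ f x * 𝟙 (R? x y) + f′ y
      split y with R? x y
      ... | yes xRy = ≡.trans (≡.sym (inv xRy)) (≡.sym (≡.trans (+-identityʳ _) (*-identityʳ (f x))))
      ... | no  _   = ≡.cong (_+ f y) (≡.sym (*-zeroʳ (f x)))

      total : sum f ≡ f x * m + sum f′
      total = begin
        sum f                                              ≡⟨ sum-cong-≗ split ⟩
        sum (λ y → f x * 𝟙 (R? x y) + f′ y)                ≡⟨ ∑-distrib-+ (λ y → f x * 𝟙 (R? x y)) f′ ⟩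
        sum (λ y → f x * 𝟙 (R? x y)) + sum f′              ≡⟨ ≡.cong (_+ sum f′) (*-distribˡ-sum (f x) (λ y → 𝟙 (R? x y))) ⟨
        f x * sum (λ y → 𝟙 (R? x y)) + sum f′              ≡⟨ ≡.cong (λ k → f x * k + sum f′) (size x) ⟩
        f x * m + sum f′                                   ∎
        where open ≡.≡-Reasoning

      inv′ : ∀ {y z} → R y z → f′ y ≡ f′ z
      inv′ {y} {z} yRz with R? x y | R? x z
      ... | yes _   | yes _   = ≡.refl
      ... | yes xRy | no ¬xRz = contradiction (trans xRy yRz) ¬xRz
      ... | no ¬xRy | yes xRz = contradiction (trans xRz (sym yRz)) ¬xRy
      ... | no  _   | no  _   = inv yRz

      -- By reflexivity `x` lies in its own class. As `f x` is nonzero too, the sum strictly drops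
      -- and the recursion terminates.
      0<m : 0 < m
      0<m = ≡.subst (0 <_) (size x) (≤-trans (≤-reflexive (≡.sym (𝟙-yes (R? x x) refl)))
                                        (term≤sum (λ y → 𝟙 (R? x y)) x))

      smaller : sum f′ < sum f
      smaller = ≡.subst (sum f′ <_) (≡.sym total)
        (+-monoˡ-≤ (sum f′) (*-mono-≤ (n≢0⇒n>0 fx≢0) 0<m))

-- Stabilisers under left multiplication and their cosets.

module Cosets {n} {_∙_ : Op₂ (Fin n)} {ε} {_⁻¹} (isGroup : IsGroup _≡_ _∙_ ε _⁻¹) where

  open Data.Fin.Subset using (∣_∣)
  open Sums
  open IsGroup isGroup using (assoc; identityˡ; inverseʳ; _\\_; _//_)

  group : Group _ _
  group = record { isGroup = isGroup }

  open import Algebra.Properties.Group group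

  leftMultiplication rightMultiplication : Fin n → Permutation′ n
  leftMultiplication  a = permutation (a ∙_) (a \\_) (\\-leftDividesˡ a) (\\-leftDividesʳ a)
  rightMultiplication a = permutation (_∙ a) (_// a) (//-rightDividesˡ a) (//-rightDividesʳ a)

  -- For the indicator of a set B this says kB = B. Functions are used instead of subsets so that a
  -- translate aB is covered by its indicator.
  Stabilises : Fin n → (Fin n → ℕ) → Set
  Stabilises k f = ∀ z → f (k ∙ z) ≡ f z

  stabilises-ε : ∀ f → Stabilises ε f
  stabilises-ε f z = ≡.cong f (identityˡ z)

  stabilises-∙ : ∀ {f} {h k} → Stabilises h f → Stabilises k f → Stabilises (h ∙ k) f
  stabilises-∙ {f} {h} {k} sh sk z = ≡.trans (≡.cong f (assoc h k z)) (≡.trans (sh (k ∙ z)) (sk z))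

  stabilises-⁻¹ : ∀ {f} {k} → Stabilises k f → Stabilises (k ⁻¹) f
  stabilises-⁻¹ {f} {k} sk z = ≡.trans (≡.sym (sk (k \\ z))) (≡.cong f (\\-leftDividesˡ k z))

  -- The common stabiliser of f and f′ has more than one element, and its order
  -- divides both sums, which are unions of its right cosets.
  common-stabiliser⇒¬coprime : ∀ {f f′ k} → k ≢ ε → Stabilises k f → Stabilises k f′ →
                               ¬ Coprime (sum f) (sum f′)
  common-stabiliser⇒¬coprime {f} {f′} {k} k≢ε kf kf′ coprime =
    <⇒≢ (x≢y∈p⇒1<∣p∣ (∈-comprehension⁺ K? (kf , kf′)) (∈-comprehension⁺ K? (stabilises-ε f , stabilises-ε f′)) k≢ε)
        (≡.sym (coprime (order∣ f proj₁ , order∣ f′ proj₂)))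
    where
    K : Fin n → Set
    K h = Stabilises h f × Stabilises h f′

    K? : ∀ h → Dec (K h)
    K? h = all? (λ z → f (h ∙ z) ≟ f z) ×-dec all? (λ z → f′ (h ∙ z) ≟ f′ z)

    R : Fin n → Fin n → Set
    -- The classes of this relation are the right cosets of `K`.
    R x y = K (y // x)

    R? : Decidable R
    R? x y = K? (y // x)

    isEquivalence : IsEquivalence R
    isEquivalence = record
      { refl  = λ {x} → ≡.subst K (≡.sym (inverseʳ x)) (stabilises-ε f , stabilises-ε f′)
      ; sym   = λ {x} {y} (s , s′) → ≡.subst K (⁻¹-anti-homo-// y x) (stabilises-⁻¹ s , stabilises-⁻¹ s′)
      ; trans = λ {x} {y} {z} (s , s′) (t , t′) → ≡.subst K
          (≡.trans (≡.sym (assoc (z // y) y (x ⁻¹))) (≡.cong (_// x) (//-rightDividesˡ y z)))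
          (stabilises-∙ t s , stabilises-∙ t′ s′)
      }

    L = comprehension K?

    class-size : ∀ x → sum (λ y → 𝟙 (R? x y)) ≡ ∣ L ∣
    class-size x = begin
      sum (λ y → 𝟙 (K? (y // x)))       ≡⟨ ∑-permute (λ y → 𝟙 (K? (y // x))) (rightMultiplication x) ⟩
      sum (λ h → 𝟙 (K? ((h ∙ x) // x))) ≡⟨ sum-cong-≗ (λ h → ≡.cong (𝟙 ∘ K?) (//-rightDividesʳ x h)) ⟩
      sum (λ h → 𝟙 (K? h))              ≡⟨ sum-cong-≗ (λ h → 𝟙-cong (K? h) (h ∈? L) (∈-comprehension⁺ K?) (∈-comprehension⁻ K?)) ⟩
      sum (χ L)                         ≡⟨ ∣p∣≡sum-χ L ⟨
      ∣ L ∣                             ∎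
      where open ≡.≡-Reasoning

    order∣ : ∀ f → (∀ {h} → K h → Stabilises h f) → ∣ L ∣ ∣ sum f
    order∣ f stab = class-size∣sum R? isEquivalence ∣ L ∣ class-size f λ {x} {y} xRy →
      ≡.trans (≡.sym (stab xRy x)) (≡.cong f (//-rightDividesˡ x y))

-- Orbits of a group acting by automorphisms on a group with carrier `Fin n`.

module Orbits {n} {_∙_ : Op₂ (Fin n)} {ε} {_⁻¹} (isGroup : IsGroup _≡_ _∙_ ε _⁻¹)
  {c ℓ} (Γ : Group c ℓ)
  (_·_ : Group.Carrier Γ → Fin n → Fin n)
  (·-cong : ∀ {g h} → Group._≈_ Γ g h → ∀ x → g · x ≡ h · x)
  (·-identity : ∀ x → Group.ε Γ · x ≡ x)
  (·-assoc : ∀ g h x → Group._∙_ Γ g h · x ≡ g · (h · x))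
  (·-homo : ∀ g x y → g · (x ∙ y) ≡ (g · x) ∙ (g · y))
  -- Membership in the orbit of a pair has to be decidable in order to be counted by an indicator.
  (moves? : ∀ x y x′ y′ → Dec (∃[ g ] (g · x ≡ x′ × g · y ≡ y′)))
  where

  open Data.Fin.Subset using (∣_∣)
  open Sums
  open Cosets isGroup
  open IsGroup isGroup using (assoc; identityʳ; _\\_)
  open import Algebra.Properties.Group group

  private
    module Γ = Group Γ

  cancelˡ : ∀ g x → (g Γ.⁻¹) · (g · x) ≡ x
  cancelˡ g x = ≡.trans (≡.sym (·-assoc (g Γ.⁻¹) g x)) (≡.trans (·-cong (Γ.inverseˡ g) x) (·-identity x))

  cancelʳ : ∀ g x → g · ((g Γ.⁻¹) · x) ≡ x
  cancelʳ g x = ≡.trans (≡.sym (·-assoc g (g Γ.⁻¹) x)) (≡.trans (·-cong (Γ.inverseʳ g) x) (·-identity x))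

  ·-permutation : Γ.Carrier → Permutation′ n
  ·-permutation g = permutation (g ·_) ((g Γ.⁻¹) ·_) (cancelʳ g) (cancelˡ g)

  ·-\\ : ∀ g x y → g · (x \\ y) ≡ (g · x) \\ (g · y)
  ·-\\ g x y = y≈x\\z _ _ _ (≡.trans (≡.sym (·-homo g x (x \\ y))) (≡.cong (g ·_) (\\-leftDividesˡ x y)))

  -- A nonempty invariant set on which the action is transitive. This form can be checked for a
  -- product set without describing it as the orbit of one point.
  record IsOrbit (A : Subset n) : Set c where
    field
      point      : Fin n
      point∈     : point ∈ A
      transitive : ∀ {x y} → x ∈ A → y ∈ A → ∃[ g ] g · x ≡ y
      closed     : ∀ g {x} → x ∈ A → (g · x) ∈ A

    closed⁻ : ∀ g {x} → (g · x) ∈ A → x ∈ A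
    closed⁻ g {x} gx∈A = ≡.subst (_∈ A) (cancelˡ g x) (closed (g Γ.⁻¹) gx∈A)

    χ-invariant : ∀ g x → χ A (g · x) ≡ χ A x
    χ-invariant g x = 𝟙-cong ((g · x) ∈? A) (x ∈? A) (closed⁻ g) (closed g)

    -- By transitivity `f` is constant on `A`, so it is `f x` times the indicator of `A`.
    sum-invariant : ∀ (f : Fin n → ℕ) → (∀ g x → f (g · x) ≡ f x) → (∀ {x} → x ∉ A → f x ≡ 0) →
                    ∀ {x} → x ∈ A → sum f ≡ f x * ∣ A ∣
    sum-invariant f inv supp {x} x∈A = begin
      sum f                    ≡⟨ sum-cong-≗ constant ⟩
      sum (λ y → f x * χ A y)  ≡⟨ *-distribˡ-sum (f x) (χ A) ⟨
      f x * sum (χ A)          ≡⟨ ≡.cong (f x *_) (∣p∣≡sum-χ A) ⟨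
      f x * ∣ A ∣              ∎
      where
      open ≡.≡-Reasoning
      constant : ∀ y → f y ≡ f x * χ A y
      constant y with y ∈? A
      ... | no y∉A = ≡.trans (supp y∉A) (≡.sym (*-zeroʳ (f x)))
      ... | yes y∈A with transitive x∈A y∈A
      ...   | g , ≡.refl = ≡.trans (inv g x) (≡.sym (*-identityʳ (f x)))

  open IsOrbit

  -- Let O be the orbit of (x , y) in A × B. Counting O along both projections,
  -- each row has |O| / |A| points and each column |O| / |B|; so |B| divides the
  -- size of a row, which must then be all of B.
  coprime⇒stabiliser-transitive : ∀ {A B} → IsOrbit A → IsOrbit B → Coprime ∣ A ∣ ∣ B ∣ →
    ∀ {x y j} → x ∈ A → y ∈ B → j ∈ B → ∃[ g ] (g · x ≡ x × g · y ≡ j)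
  coprime⇒stabiliser-transitive {A} {B} oA oB coprime {x} {y} {j} x∈A y∈B j∈B =
    𝟙≡1⇒ (moves? x y x j) (≡.trans (row-full j) (𝟙-yes (j ∈? B) j∈B))
    where
    M : Fin n → Fin n → ℕ
    M i j = 𝟙 (moves? x y i j)

    M-invariant : ∀ g i j → M (g · i) (g · j) ≡ M i j
    M-invariant g i j = 𝟙-cong (moves? x y (g · i) (g · j)) (moves? x y i j)
      (λ (h , p , q) → (g Γ.⁻¹) Γ.∙ h ,
        ≡.trans (·-assoc (g Γ.⁻¹) h x) (≡.trans (≡.cong ((g Γ.⁻¹) ·_) p) (cancelˡ g i)) ,
        ≡.trans (·-assoc (g Γ.⁻¹) h y) (≡.trans (≡.cong ((g Γ.⁻¹) ·_) q) (cancelˡ g j)))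
      (λ (h , p , q) → g Γ.∙ h ,
        ≡.trans (·-assoc g h x) (≡.cong (g ·_) p) , ≡.trans (·-assoc g h y) (≡.cong (g ·_) q))

    row col : Fin n → ℕ
    row i = sum (λ j → M i j)
    col j = sum (λ i → M i j)

    row-invariant : ∀ g i → row (g · i) ≡ row i
    row-invariant g i = ≡.trans (∑-permute (M (g · i)) (·-permutation g)) (sum-cong-≗ (M-invariant g i))

    col-invariant : ∀ g j → col (g · j) ≡ col j
    col-invariant g j = ≡.trans (∑-permute (λ i → M i (g · j)) (·-permutation g))
                                (sum-cong-≗ (λ i → M-invariant g i j))

    M-outsideˡ : ∀ {i} j → i ∉ A → M i j ≡ 0
    M-outsideˡ {i} j i∉A = 𝟙-no (moves? x y i j) λ (g , p , _) → i∉A (≡.subst (_∈ A) p (closed oA g x∈A))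

    M-outsideʳ : ∀ i {j} → j ∉ B → M i j ≡ 0
    M-outsideʳ i {j} j∉B = 𝟙-no (moves? x y i j) λ (g , _ , q) → j∉B (≡.subst (_∈ B) q (closed oB g y∈B))

    rows≡cols : row x * ∣ A ∣ ≡ col y * ∣ B ∣
    rows≡cols = begin
      row x * ∣ A ∣  ≡⟨ sum-invariant oA row row-invariant (λ i∉A → sum-zero λ j → M-outsideˡ j i∉A) x∈A ⟨
      sum row        ≡⟨ ∑-comm M ⟩
      sum col        ≡⟨ sum-invariant oB col col-invariant (λ j∉B → sum-zero λ i → M-outsideʳ i j∉B) y∈B ⟩
      col y * ∣ B ∣  ∎
      where open ≡.≡-Reasoning

    ∣B∣∣row : ∣ B ∣ ∣ row x
    ∣B∣∣row = coprime-divisor (Coprimality.sym coprime)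
      (divides (col y) (≡.trans (*-comm ∣ A ∣ (row x)) rows≡cols))

    -- The pair lies in its own orbit, so the row is nonzero and divisibility by the order of `B`
    -- bounds it from below.
    1≤row : 1 ≤ row x
    1≤row = ≤-trans (≤-reflexive (≡.sym (𝟙-yes (moves? x y x y) (Γ.ε , ·-identity x , ·-identity y))))
                    (term≤sum (M x) y)

    M≤χ : ∀ j → M x j ≤ χ B j
    M≤χ j = 𝟙-mono (moves? x y x j) (j ∈? B) λ (g , _ , q) → ≡.subst (_∈ B) q (closed oB g y∈B)

    row-full : M x ≗ χ B
    row-full = ≤∧sum≡⇒≗ M≤χ (≤-antisym (sum-mono-≤ M≤χ)
      (≡.subst (_≤ row x) (∣p∣≡sum-χ B) (∣⇒≤ {{>-nonZero 1≤row}} ∣B∣∣row)))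

  -- The product set of two orbits.

  module Product (A B : Subset n) where

    -- The second factor is recovered from `z` and `i` by left division, so a single search over `i`
    -- decides membership.
    _∈AB : Fin n → Set
    z ∈AB = ∃[ i ] (i ∈ A × (i \\ z) ∈ B)

    ∈AB? : ∀ z → Dec (z ∈AB)
    ∈AB? z = any? λ i → (i ∈? A) ×-dec ((i \\ z) ∈? B)

    AB : Subset n
    AB = comprehension ∈AB?

    ∙∈AB : ∀ {a b} → a ∈ A → b ∈ B → (a ∙ b) ∈ AB
    ∙∈AB {a} {b} a∈A b∈B =
      ∈-comprehension⁺ ∈AB? (a , a∈A , ≡.subst (_∈ B) (≡.sym (\\-leftDividesʳ a b)) b∈B)

    -- The summand is the indicator of the translate aB, and left multiplication by `a` is a
    -- bijection.
    sum-translate : ∀ a → sum (λ z → χ B (a \\ z)) ≡ ∣ B ∣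
    sum-translate a = begin
      sum (λ z → χ B (a \\ z))        ≡⟨ ∑-permute (λ z → χ B (a \\ z)) (leftMultiplication a) ⟩
      sum (λ z → χ B (a \\ (a ∙ z)))  ≡⟨ sum-cong-≗ (λ z → ≡.cong (χ B) (\\-leftDividesʳ a z)) ⟩
      sum (χ B)                       ≡⟨ ∣p∣≡sum-χ B ⟨
      ∣ B ∣                           ∎
      where open ≡.≡-Reasoning

    translate≤ : ∀ {a} → a ∈ A → ∀ z → χ B (a \\ z) ≤ χ AB z
    translate≤ {a} a∈A z = 𝟙-mono ((a \\ z) ∈? B) (z ∈? AB) λ a\\z∈B → ∈-comprehension⁺ ∈AB? (a , a∈A , a\\z∈B)

    ∣B∣≤∣AB∣ : ∀ {a} → a ∈ A → ∣ B ∣ ≤ ∣ AB ∣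
    ∣B∣≤∣AB∣ {a} a∈A = ≡.subst₂ _≤_ (sum-translate a) (≡.sym (∣p∣≡sum-χ AB)) (sum-mono-≤ (translate≤ a∈A))

    -- The translate aB lies in AB and has the size of `B`, so equality of sizes makes it all of AB.
    translate≗ : ∣ AB ∣ ≡ ∣ B ∣ → ∀ {a} → a ∈ A → ∀ z → χ B (a \\ z) ≡ χ AB z
    translate≗ eq {a} a∈A = ≤∧sum≡⇒≗ (translate≤ a∈A)
      (≡.trans (sum-translate a) (≡.trans (≡.sym eq) (∣p∣≡sum-χ AB)))

    module _ (oA : IsOrbit A) (oB : IsOrbit B) (coprime : Coprime ∣ A ∣ ∣ B ∣) where

      isOrbit : IsOrbit AB
      isOrbit = record
        { point      = point oA ∙ point oB
        ; point∈     = ∙∈AB (point∈ oA) (point∈ oB)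
        ; transitive = λ z∈ w∈ → trans′ (∈-comprehension⁻ ∈AB? z∈) (∈-comprehension⁻ ∈AB? w∈)
        ; closed     = λ g z∈ → let (i , i∈A , i\\z∈B) = ∈-comprehension⁻ ∈AB? z∈ in
            ∈-comprehension⁺ ∈AB? (g · i , closed oA g i∈A , ≡.subst (_∈ B) (·-\\ g i _) (closed oB g i\\z∈B))
        }
        where
        -- First `h` carries `i` to `i′`; then `k`, which fixes `i′`, corrects the second factor.
        -- Coprimality supplies `k`.
        trans′ : ∀ {z w} → z ∈AB → w ∈AB → ∃[ g ] g · z ≡ w
        trans′ {z} {w} (i , i∈A , b∈B) (i′ , i′∈A , b′∈B)
          with transitive oA i∈A i′∈A
        ... | h , ≡.refl
          with coprime⇒stabiliser-transitive oA oB coprime i′∈A (closed oB h b∈B) b′∈B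
        ... | k , k-fixes , k-moves = k Γ.∙ h , (begin
          (k Γ.∙ h) · z                             ≡⟨ ·-assoc k h z ⟩
          k · (h · z)                               ≡⟨ ≡.cong (λ u → k · (h · u)) (\\-leftDividesˡ i z) ⟨
          k · (h · (i ∙ (i \\ z)))                  ≡⟨ ≡.cong (k ·_) (·-homo h i (i \\ z)) ⟩
          k · ((h · i) ∙ (h · (i \\ z)))            ≡⟨ ·-homo k (h · i) (h · (i \\ z)) ⟩
          (k · (h · i)) ∙ (k · (h · (i \\ z)))      ≡⟨ ≡.cong₂ _∙_ k-fixes k-moves ⟩
          (h · i) ∙ ((h · i) \\ w)                  ≡⟨ \\-leftDividesˡ (h · i) w ⟩
          w                                         ∎)
          where open ≡.≡-Reasoning

      -- N z is the number of factorisations z = i b with i ∈ A and b ∈ B.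
      ∣AB∣∣∣A∣*∣B∣ : ∣ AB ∣ ∣ ∣ A ∣ * ∣ B ∣
      ∣AB∣∣∣A∣*∣B∣ = divides (N (point isOrbit)) (begin
        ∣ A ∣ * ∣ B ∣                                ≡⟨ ≡.cong (_* ∣ B ∣) (∣p∣≡sum-χ A) ⟩
        sum (χ A) * ∣ B ∣                            ≡⟨ *-distribʳ-sum ∣ B ∣ (χ A) ⟩
        sum (λ i → χ A i * ∣ B ∣)                    ≡⟨ sum-cong-≗ (λ i → ≡.cong (χ A i *_) (sum-translate i)) ⟨
        sum (λ i → χ A i * sum (λ z → χ B (i \\ z))) ≡⟨ sum-cong-≗ (λ i → *-distribˡ-sum (χ A i) (λ z → χ B (i \\ z))) ⟩
        sum (λ i → sum (λ z → F i z))                ≡⟨ ∑-comm F ⟩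
        -- `N` is invariant and vanishes off `AB`, hence is constant on this orbit.
        sum N                                        ≡⟨ sum-invariant isOrbit N N-invariant N-outside (point∈ isOrbit) ⟩
        N (point isOrbit) * ∣ AB ∣                   ∎)
        where
        open ≡.≡-Reasoning
        F : Fin n → Fin n → ℕ
        F i z = χ A i * χ B (i \\ z)

        N : Fin n → ℕ
        N z = sum (λ i → F i z)

        N-invariant : ∀ g z → N (g · z) ≡ N z
        N-invariant g z = ≡.trans (∑-permute (λ i → F i (g · z)) (·-permutation g)) (sum-cong-≗ λ i →
          ≡.cong₂ _*_ (χ-invariant oA g i)
            (≡.trans (≡.cong (χ B) (≡.sym (·-\\ g i z))) (χ-invariant oB g (i \\ z))))

        N-outside : ∀ {z} → z ∉ AB → N z ≡ 0
        N-outside {z} z∉AB = sum-zero vanish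
          where
          vanish : ∀ i → F i z ≡ 0
          vanish i with i ∈? A
          ... | no  _   = ≡.refl
          ... | yes i∈A = ≡.trans (+-identityʳ _)
            (𝟙-no ((i \\ z) ∈? B) λ i\\z∈B → z∉AB (∈-comprehension⁺ ∈AB? (i , i∈A , i\\z∈B)))

  -- Absorption between orbits and the stabilisers it produces.

  open Product using (AB; ∣B∣≤∣AB∣; translate≗; ∣AB∣∣∣A∣*∣B∣)

  -- The order of AB divides the product of the two orders and is at least that of `B`. If coprime
  -- to the order of `A`, it divides that of `B`, hence equals it; if coprime to that of `B`, it
  -- would divide the smaller order of `A`.
  coprime-to-factor⇒∣AB∣≡∣B∣ : ∀ {A B} → IsOrbit A → IsOrbit B → Coprime ∣ A ∣ ∣ B ∣ → ∣ A ∣ < ∣ B ∣ →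
    (Coprime ∣ AB A B ∣ ∣ A ∣) ⊎ (Coprime ∣ AB A B ∣ ∣ B ∣) → ∣ AB A B ∣ ≡ ∣ B ∣
  coprime-to-factor⇒∣AB∣≡∣B∣ {A} {B} oA oB coprime A<B = λ
    { (inj₁ coprimeA) → ≤-antisym
        (∣⇒≤ {{>-nonZero (x∈p⇒0<∣p∣ (point∈ oB))}} (coprime-divisor coprimeA AB∣))
        B≤AB
    ; (inj₂ coprimeB) → contradiction
        (∣⇒≤ {{>-nonZero (x∈p⇒0<∣p∣ (point∈ oA))}}
          (coprime-divisor coprimeB (≡.subst (∣ AB A B ∣ ∣_) (*-comm ∣ A ∣ ∣ B ∣) AB∣)))
        (<⇒≱ (<-≤-trans A<B B≤AB))
    }
    where
    AB∣  = ∣AB∣∣∣A∣*∣B∣ A B oA oB coprime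
    B≤AB = ∣B∣≤∣AB∣ A B (point∈ oA)

  -- In terms of sets: a B = a′ B for all a , a′ ∈ A.
  Absorbs : Subset n → Subset n → Set
  Absorbs B A = ∀ {a a′} → a ∈ A → a′ ∈ A → ∀ z → χ B (a \\ z) ≡ χ B (a′ \\ z)

  ∣AB∣≡∣B∣⇒absorbs : ∀ {A B} → ∣ AB A B ∣ ≡ ∣ B ∣ → Absorbs B A
  ∣AB∣≡∣B∣⇒absorbs {A} {B} eq a∈A a′∈A z =
    ≡.trans (translate≗ A B eq a∈A z) (≡.sym (translate≗ A B eq a′∈A z))

  -- Multiplying aB = a′B on the left by a⁻¹ gives B = a⁻¹a′B.
  absorbs⇒stabilises : ∀ {A B a a′} → Absorbs B A → a ∈ A → a′ ∈ A → Stabilises (a \\ a′) (χ B)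
  absorbs⇒stabilises {A} {B} {a} {a′} abs a∈A a′∈A z = begin
    χ B ((a \\ a′) ∙ z)   ≡⟨ ≡.cong (χ B) (assoc (a ⁻¹) a′ z) ⟩
    χ B (a \\ (a′ ∙ z))   ≡⟨ abs a∈A a′∈A (a′ ∙ z) ⟩
    χ B (a′ \\ (a′ ∙ z))  ≡⟨ ≡.cong (χ B) (\\-leftDividesʳ a′ z) ⟩
    χ B z                 ∎
    where open ≡.≡-Reasoning

  a≢a′⇒a\\a′≢ε : ∀ {a a′} → a ≢ a′ → a \\ a′ ≢ ε
  a≢a′⇒a\\a′≢ε {a} {a′} a≢a′ eq = a≢a′ (≡.sym (≡.trans (≡.sym (\\-leftDividesˡ a a′))
    (≡.trans (≡.cong (a ∙_) eq) (identityʳ a))))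

  -- For distinct a, a′ in `A`, the nontrivial element a⁻¹a′ stabilises both `B` and `C`.
  absorb-common⇒¬coprime : ∀ {A B C} → 1 < ∣ A ∣ → Absorbs B A → Absorbs C A → ¬ Coprime ∣ B ∣ ∣ C ∣
  absorb-common⇒¬coprime {A} {B} {C} 1<A absB absC coprime with two-elements 1<A
  ... | a , a′ , a∈A , a′∈A , a≢a′ = common-stabiliser⇒¬coprime (a≢a′⇒a\\a′≢ε a≢a′)
    (absorbs⇒stabilises absB a∈A a′∈A) (absorbs⇒stabilises absC a∈A a′∈A)
    (≡.subst₂ Coprime (∣p∣≡sum-χ B) (∣p∣≡sum-χ C) coprime)

  -- If k = b⁻¹ b′ stabilises A and a ∈ A, then k a ∈ A, so k (a C) = a C.
  absorb-chain⇒¬coprime : ∀ {A B C a} → a ∈ A → 1 < ∣ B ∣ → Absorbs A B → Absorbs C A → ¬ Coprime ∣ A ∣ ∣ C ∣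
  absorb-chain⇒¬coprime {A} {B} {C} {a} a∈A 1<B absA absC coprime with two-elements 1<B
  ... | b , b′ , b∈B , b′∈B , b≢b′ = common-stabiliser⇒¬coprime (a≢a′⇒a\\a′≢ε b≢b′) kA kaC
    (≡.subst₂ Coprime (∣p∣≡sum-χ A) (≡.sym (Product.sum-translate A C a)) coprime)
    where
    k = b \\ b′

    kA : Stabilises k (χ A)
    kA = absorbs⇒stabilises absA b∈B b′∈B

    ka∈A : (k ∙ a) ∈ A
    ka∈A = 𝟙≡1⇒ ((k ∙ a) ∈? A) (≡.trans (kA a) (𝟙-yes (a ∈? A) a∈A))

    kaC : Stabilises k (λ z → χ C (a \\ z))
    -- Absorption permits replacing `a` by `k ∙ a`, after which `k` cancels.
    kaC z = ≡.trans (absC a∈A ka∈A (k ∙ z)) (≡.cong (χ C) (begin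
      (k ∙ a) \\ (k ∙ z)           ≡⟨ ≡.cong (_∙ (k ∙ z)) (⁻¹-anti-homo-∙ k a) ⟩
      ((a ⁻¹) ∙ (k ⁻¹)) ∙ (k ∙ z)  ≡⟨ assoc (a ⁻¹) (k ⁻¹) (k ∙ z) ⟩
      a \\ (k \\ (k ∙ z))          ≡⟨ ≡.cong (a \\_) (\\-leftDividesʳ k z) ⟩
      a \\ z                       ∎))
      where open ≡.≡-Reasoning

  ∈⇔moved⇒isOrbit : ∀ {A p} → (∀ z → z ∈ A ⇔ (∃[ g ] g · p ≡ z)) → IsOrbit A
  ∈⇔moved⇒isOrbit {A} {p} ∈⇔ = record
    { point      = p
    ; point∈     = from (∈⇔ p) (Γ.ε , ·-identity p)
    ; transitive = λ {x} {y} x∈A y∈A →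
        let (g , gp≡x) = to (∈⇔ x) x∈A
            (h , hp≡y) = to (∈⇔ y) y∈A
        in h Γ.∙ (g Γ.⁻¹) , ≡.trans (·-assoc h (g Γ.⁻¹) x) (≡.trans (≡.cong (h ·_)
             (≡.trans (≡.cong ((g Γ.⁻¹) ·_) (≡.sym gp≡x)) (cancelˡ g p))) hp≡y)
    ; closed     = λ g {x} x∈A →
        let (h , hp≡x) = to (∈⇔ x) x∈A
        in from (∈⇔ (g · x)) (g Γ.∙ h , ≡.trans (·-assoc g h p) (≡.cong (g ·_) hp≡x))
    }
    where open Equivalence

-- Transport of the group `H` and the action to indices.

module _ {c₁ ℓ₁ c₂ ℓ₂} (G : FiniteGroup c₁ ℓ₁) (H : FiniteGroup c₂ ℓ₂) (α : Action G H) where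

  open Data.Fin.Subset using (∣_∣)

  private
    module G = FiniteGroup G
    module H = FiniteGroup H
    module α = GroupHomomorphism α
    module _ (g : G.Carrier) where
      open Automorphism (α.⟦ g ⟧) public using () renaming (⟦⟧-cong to act-cong; ∙-homo to act-homo)

  open Inverse H.enumeration using (from; from-cong) renaming
    ( to-cong          to index-cong
    ; strictlyInverseˡ to index-from
    ; strictlyInverseʳ to from-index
    )

  -- A copy of `H` on `Fin H.order`, where equality is propositional and decidable and orbits are
  -- subsets of the carrier itself.
  rawIndexGroup : RawGroup _ _
  rawIndexGroup = record
    { Carrier = Fin H.order
    ; _≈_     = _≡_
    ; _∙_     = λ i j → H.index (from i H.∙ from j)
    ; ε       = H.index H.ε
    ; _⁻¹     = λ i → H.index (from i H.⁻¹)
    }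

  from-isGroupMonomorphism : IsGroupMonomorphism rawIndexGroup H.rawGroup from
  from-isGroupMonomorphism = record
    { isGroupHomomorphism = record
      { isMonoidHomomorphism = record
        { isMagmaHomomorphism = record
          { isRelHomomorphism = record { cong = from-cong }
          ; homo              = λ i j → from-index _
          }
        ; ε-homo = from-index _
        }
      ; ⁻¹-homo = λ i → from-index _
      }
    ; injective = λ {i} {j} eq →
        ≡.trans (≡.sym (index-from i)) (≡.trans (index-cong eq) (index-from j))
    }

  infixr 8 _·_

  _·_ : G.Carrier → Fin H.order → Fin H.order
  g · i = H.index (act {G = G} {H = H} α g (from i))

  ·-index : ∀ g x → g · H.index x ≡ H.index (act {G = G} {H = H} α g x)
  ·-index g x = index-cong (act-cong g (from-index x))

  ·-cong : ∀ {g h} → g G.≈ h → ∀ i → g · i ≡ h · i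
  ·-cong g≈h i = index-cong (α.⟦⟧-cong g≈h (from i))

  -- An exhaustive search through the enumeration of `G`; equal group elements act equally, so
  -- representatives suffice.
  moves? : ∀ x y x′ y′ → Dec (∃[ g ] (g · x ≡ x′ × g · y ≡ y′))
  moves? x y x′ y′ = map′
    (λ (i , p , q) → element i , p , q)
    (λ (g , p , q) → G.index g , ≡.trans (·-cong (element-index g) x) p , ≡.trans (·-cong (element-index g) y) q)
    (any? λ i → (element i · x ≟ᶠ x′) ×-dec (element i · y ≟ᶠ y′))
    where open Inverse G.enumeration using () renaming (from to element; strictlyInverseʳ to element-index)

  open RawGroup rawIndexGroup using (_∙_)

  isIndexGroup : IsGroup _≡_ _∙_ (RawGroup.ε rawIndexGroup) (RawGroup._⁻¹ rawIndexGroup)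
  isIndexGroup = GroupMonomorphism.isGroup from-isGroupMonomorphism H.isGroup

  ·-identity : ∀ i → G.ε · i ≡ i
  ·-identity i = ≡.trans (index-cong (α.ε-homo (from i))) (index-from i)

  ·-assoc : ∀ g h i → (g G.∙ h) · i ≡ g · (h · i)
  ·-assoc g h i = ≡.trans (index-cong (α.homo g h (from i))) (≡.sym (·-index g _))

  ·-homo : ∀ g i j → g · (i ∙ j) ≡ (g · i) ∙ (g · j)
  ·-homo g i j = ≡.trans (·-index g _) (≡.trans (index-cong (act-homo g (from i) (from j)))
    (index-cong (H.sym (H.∙-cong (from-index _) (from-index _)))))

  open Orbits isIndexGroup G.group _·_ ·-cong ·-identity ·-assoc ·-homo moves?

  -- Shortening walks in the common divisor graph.

  private
    graph = commonDivisorGraph {G = G} {H = H} α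

  open SimpleGraph graph
  open Walks graph
  open NontrivialOrbit

  vertex-isOrbit : ∀ (L : Vertex) → IsOrbit (points L)
  vertex-isOrbit L with isOrbit L
  ... | h , ∈⇔ = ∈⇔moved⇒isOrbit {p = H.index h} λ z → mk⇔
    (λ z∈L → let (g , gh≈z) = Equivalence.to (∈⇔ (from z)) (≡.subst (_∈ points L) (≡.sym (index-from z)) z∈L)
             in g , ≡.trans (·-index g h) (≡.trans (index-cong gh≈z) (index-from z)))
    (λ (g , gh≡z) → ≡.subst (_∈ points L) (≡.trans (≡.sym (·-index g h)) gh≡z)
      (Equivalence.from (∈⇔ (act {G = G} {H = H} α g h)) (g , H.refl)))

  orbit-vertex : ∀ {A} → IsOrbit A → 1 < ∣ A ∣ → Vertex
  orbit-vertex {A} oA 1<A = record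
    { points     = A
    ; isOrbit    = from point , λ x → mk⇔
        (λ x∈A → let (g , eq) = transitive point∈ x∈A
                 in g , H.trans (H.sym (from-index _)) (H.trans (from-cong eq) (from-index x)))
        (λ (g , gp≈x) → ≡.subst (_∈ A) (index-cong gp≈x) (closed g point∈))
    ; nontrivial = 1<A
    }
    where open IsOrbit oA

  _≈?_ : Decidable _≈ᵥ_
  L ≈? M = ≡-dec _≟ᵇ_ (points L) (points M)

  -- The bound allows length 0 because the two orbits may coincide, and then no edge joins them.
  walk≤1 : ∀ L M → ¬ Coprime (size L) (size M) → Walk≤ 1 L M
  walk≤1 L M ¬coprime with L ≈? M
  ... | yes L≈M = 0 , z≤n , nil L≈M
  ... | no  L≉M = exact (cons {y = M} (L≉M , λ gcd≡1 → ¬coprime (gcd≡1⇒coprime gcd≡1)) (nil ≡.refl))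

  same-size⇒walk≤1 : ∀ L M → size L ≡ size M → Walk≤ 1 L M
  same-size⇒walk≤1 L M L≡M = walk≤1 L M λ coprime →
    <⇒≢ (nontrivial L) (≡.sym (coprime (∣-refl , ∣-reflexive L≡M)))

  -- For coprime sizes the product orbit `LM` is the candidate middle vertex; if its size is coprime
  -- to one of the two, absorption follows.
  walk≤2-or-absorbs : ∀ L M → size L < size M → Walk≤ 2 L M ⊎ Absorbs (points M) (points L)
  walk≤2-or-absorbs L M L<M with coprime? (size L) (size M)
  ... | no ¬coprime = inj₁ (weaken (s≤s z≤n) (walk≤1 L M ¬coprime))
  ... | yes coprime = by-cases (coprime? (size LM) (size L)) (coprime? (size LM) (size M))
    where
    oL = vertex-isOrbit L
    oM = vertex-isOrbit M

    LM : Vertex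
    LM = orbit-vertex (Product.isOrbit _ _ oL oM coprime)
      (<-≤-trans (nontrivial M) (Product.∣B∣≤∣AB∣ _ _ (IsOrbit.point∈ oL)))

    absorbs : (Coprime (size LM) (size L)) ⊎ (Coprime (size LM) (size M)) → Absorbs (points M) (points L)
    absorbs c = ∣AB∣≡∣B∣⇒absorbs (coprime-to-factor⇒∣AB∣≡∣B∣ oL oM coprime L<M c)

    by-cases : Dec (Coprime (size LM) (size L)) → Dec (Coprime (size LM) (size M)) →
               Walk≤ 2 L M ⊎ Absorbs (points M) (points L)
    by-cases (yes c) _       = inj₂ (absorbs (inj₁ c))
    by-cases (no _)  (yes c) = inj₂ (absorbs (inj₂ c))
    by-cases (no ¬c) (no ¬d) = inj₁ (walk≤1 L LM (¬c ∘ Coprimality.sym) ++≤ walk≤1 LM M ¬d)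

  -- Each alternative replaces a piece of a walk from `L` through `M` to `N` by a shorter one.
  -- Failing all three, the sizes of `L` and `M` decide which forbidden pattern of absorption
  -- arises.
  triangle : ∀ L M N → size L < size N → Walk≤ 2 L M ⊎ Walk≤ 2 L N ⊎ Walk≤ 1 M N
  triangle L M N L<N with coprime? (size M) (size N) | walk≤2-or-absorbs L N L<N
  ... | no ¬coprime | _        = inj₂ (inj₂ (walk≤1 M N ¬coprime))
  ... | yes _       | inj₁ w   = inj₂ (inj₁ w)
  ... | yes coprime | inj₂ absN with <-cmp (size L) (size M)
  ...   | tri≈ _ L≡M _ = inj₁ (weaken (s≤s z≤n) (same-size⇒walk≤1 L M L≡M))
  ...   | tri< L<M _ _ with walk≤2-or-absorbs L M L<M
  ...     | inj₁ w    = inj₁ w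
  -- Here `M` and `N` both absorb `L`.
  ...     | inj₂ absM = ⊥-elim (absorb-common⇒¬coprime (nontrivial L) absM absN coprime)
  triangle L M N L<N | yes coprime | inj₂ absN | tri> _ _ M<L with walk≤2-or-absorbs M L M<L
  ...     | inj₁ w    = inj₁ (reverse≤ w)
  ...     | inj₂ absL with coprime? (size L) (size N)
  -- Here `N` absorbs `L`, and `L` absorbs `M`.
  ...       | yes c = ⊥-elim
    (absorb-chain⇒¬coprime (IsOrbit.point∈ (vertex-isOrbit L)) (nontrivial M) absL absN c)
  ...       | no ¬c = inj₂ (inj₁ (weaken (s≤s z≤n) (walk≤1 L N ¬c)))

  -- The three alternatives give lengths at most 2 + 2, 2 and 3 + 1.
  shorten-ascending : ∀ {L M N} → size L < size N → Walk 3 L M → Walk 2 M N → Walk≤ 4 L N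
  shorten-ascending {L} {M} {N} L<N v w with triangle L M N L<N
  ... | inj₁ v′        = v′ ++≤ exact w
  ... | inj₂ (inj₁ u)  = weaken (s≤s (s≤s z≤n)) u
  ... | inj₂ (inj₂ w′) = exact v ++≤ w′

  -- Reversing the walk puts the smaller orbit first; ends of equal size share a divisor greater
  -- than 1 and are adjacent or equal.
  shorten₅ : ∀ {L N} → Walk 5 L N → Walk≤ 4 L N
  shorten₅ {L} {N} w with <-cmp (size L) (size N)
  ... | tri< L<N _ _ = let (_ , u , v) = split 3 w in shorten-ascending L<N u v
  ... | tri> _ _ N<L = let (_ , u , v) = split 3 (reverse w) in reverse≤ (shorten-ascending N<L u v)
  ... | tri≈ _ L≡N _ = weaken (s≤s z≤n) (same-size⇒walk≤1 L N L≡N)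

  component-diameter≤4 : ∀ L M → SameComponent L M → ∃[ k ] (k ≤ 4 × Path k L M)
  component-diameter≤4 L M (_ , w , _) with shorten shorten₅ w
  ... | k , k≤4 , w′ with walk⇒path _≈?_ w′
  ...   | l , l≤k , p = l , ≤-trans l≤k k≤4 , p

mainTheorem3 : ∀ {c₁ ℓ₁ c₂ ℓ₂} (G : FiniteGroup c₁ ℓ₁) (H : FiniteGroup c₂ ℓ₂) →
    (∀ p → Prime p → p ∣ FiniteGroup.order G ⇔ p ∣ FiniteGroup.order H) →
    (α : Action G H) →
    let open SimpleGraph (commonDivisorGraph {G = G} {H = H} α) in
    ∀ L₁ L₂ → SameComponent L₁ L₂ → ∃[ k ] (k ≤ 4 × Path k L₁ L₂)
mainTheorem3 G H _ α = component-diameter≤4 G H α
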